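{- For every pair of constants $p$ and $k$ (positive integers), there is a polynomial-time algorithm that, given a $K_p$-free semi-perfect graph $G$ together with a clique partition of $G$ consisting of exactly $\alpha(G)$ cliques, decides whether $\mu_\alpha(G)\le k$.
   Context: All graphs are finite, simple and undirected. $K_p$ is the complete graph on $p$ vertices; $G$ is $K_p$-free if it has no induced subgraph isomorphic to $K_p$ (i.e., no clique of size $p$). For a graph $G$, $\alpha(G)$ is the maximum size of an independent set and $i(G)$ is the minimum size of a maximal (with respect to inclusion) independent set; the independence gap is $\mu_\alpha(G)=\alpha(G)-i(G)$. $\theta(G)$ denotes the minimum number of cliques whose union is $V(G)$; $G$ is semi-perfect if $\alpha(G)=\theta(G)$. A clique partition of $G$ is a set of pairwise disjoint cliques whose union is $V(G)$. -}

module Defs where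

open import Data.Bool.Base using (Bool; true; false; T; if_then_else_)
open import Data.Fin.Base using (Fin)
open import Data.Fin.Subset using (Subset; _∈_; _⊆_; _∩_; ∣_∣; Empty)
open import Data.List.Base using (List; []; _∷_; _++_; length; concat; tabulate)
open import Data.Nat.Base using (ℕ; zero; suc; _+_; _*_; _∸_; _^_; _≤_)
open import Data.Nat.Properties using (_≟_)
open import Data.Product.Base using (∃; ∃-syntax; _×_)
open import Data.Sum.Base using (_⊎_)
open import Data.Vec.Base using (lookup)
open import Relation.Binary.Definitions using (Symmetric; Irreflexive)
open import Relation.Binary.PropositionalEquality.Core using (_≡_; _≢_)
open import Relation.Nullary using (¬_; does)

------------------------------------------------------------------------
-- Graphs

record Graph (n : ℕ) : Set where
  field
    adj        : Fin n → Fin n → Bool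

  Adj : Fin n → Fin n → Set
  Adj u v = T (adj u v)

  field
    adj-sym    : Symmetric Adj
    adj-irrefl : Irreflexive _≡_ Adj

open Graph public

IsGreatest : (ℕ → Set) → ℕ → Set
IsGreatest P m = P m × (∀ j → P j → j ≤ m)

IsLeast : (ℕ → Set) → ℕ → Set
IsLeast P m = P m × (∀ j → P j → m ≤ j)

module _ {n : ℕ} (G : Graph n) where

  IsClique : Subset n → Set
  IsClique S = ∀ {u v} → u ∈ S → v ∈ S → u ≢ v → Adj G u v

  IsIndependent : Subset n → Set
  IsIndependent S = ∀ {u v} → u ∈ S → v ∈ S → ¬ Adj G u v

  IsMaximalIndependent : Subset n → Set
  IsMaximalIndependent S =
    IsIndependent S × (∀ S′ → IsIndependent S′ → S ⊆ S′ → S′ ⊆ S)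

  K[_]-Free : ℕ → Set
  K[ p ]-Free = ¬ (∃[ S ] (IsClique S × ∣ S ∣ ≡ p))

  IsCliqueCover : ∀ {m} → (Fin m → Subset n) → Set
  IsCliqueCover Q = (∀ j → IsClique (Q j)) × (∀ v → ∃[ j ] v ∈ Q j)

  -- An empty part is not excluded here, but it cannot occur when the
  -- number of parts is α(G): dropping it would leave a cover by fewer
  -- than α(G) cliques.
  IsCliquePartition : ∀ {m} → (Fin m → Subset n) → Set
  IsCliquePartition Q =
    IsCliqueCover Q × (∀ {i j} → i ≢ j → Empty (Q i ∩ Q j))

  -- "α(G) = a", "i(G) = b", "θ(G) = c" and "μ_α(G) = g".
  Isα : ℕ → Set
  Isα = IsGreatest (λ s → ∃[ S ] (IsIndependent S × ∣ S ∣ ≡ s))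

  Isi : ℕ → Set
  Isi = IsLeast (λ s → ∃[ S ] (IsMaximalIndependent S × ∣ S ∣ ≡ s))

  Isθ : ℕ → Set
  Isθ = IsLeast (λ m → ∃[ Q ] IsCliqueCover {m} Q)

  -- Truncated subtraction is exact, as i(G) ≤ α(G).
  Isμα : ℕ → Set
  Isμα g = ∃[ a ] ∃[ b ] (Isα a × Isi b × g ≡ a ∸ b)

  SemiPerfect : Set
  SemiPerfect = ∃[ m ] (Isα m × Isθ m)

------------------------------------------------------------------------
-- Polynomial time
--
-- The machine is a unit-cost random access machine: registers, an
-- indirectly addressed memory, and addition and truncated subtraction
-- as its only arithmetic.  Apart from the constants of the program, a step
-- lengthens the longest number in use by at most one bit, so the machine is
-- polynomially equivalent to Turing machines.

infix  7 _≔const_ _≔_⊕_ _≔_⊖_ _≔mem[_] mem[_]≔_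
infix  6 ifnz_then_else_ whilenz_loop_
infixr 5 _⨾_

-- Registers are named by their index.
data Cmd : Set where
  _≔const_   : (x c : ℕ) → Cmd
  _≔_⊕_      : (x y z : ℕ) → Cmd
  _≔_⊖_      : (x y z : ℕ) → Cmd
  _≔mem[_]   : (x y : ℕ) → Cmd
  mem[_]≔_   : (x y : ℕ) → Cmd
  skip       : Cmd
  _⨾_        : Cmd → Cmd → Cmd
  ifnz_then_else_ : ℕ → Cmd → Cmd → Cmd
  whilenz_loop_   : ℕ → Cmd → Cmd

record State : Set where
  constructor state
  field
    reg : ℕ → ℕ
    mem : ℕ → ℕ

open State public

_[_↦_] : (ℕ → ℕ) → ℕ → ℕ → (ℕ → ℕ)
(f [ x ↦ v ]) y = if does (y ≟ x) then v else f y

setReg : State → ℕ → ℕ → State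
setReg s x v = state (reg s [ x ↦ v ]) (mem s)

setMem : State → ℕ → ℕ → State
setMem s a v = state (reg s) (mem s [ a ↦ v ])

infix 4 ⟨_,_⟩⇓[_]_

-- ⟨ c , s ⟩⇓[ t ] s′: started in s, command c halts in s′ after exactly
-- t steps.
data ⟨_,_⟩⇓[_]_ : Cmd → State → ℕ → State → Set where
  const  : ∀ {s x c} → ⟨ x ≔const c , s ⟩⇓[ 1 ] setReg s x c
  add    : ∀ {s x y z} →
           ⟨ x ≔ y ⊕ z , s ⟩⇓[ 1 ] setReg s x (reg s y + reg s z)
  sub    : ∀ {s x y z} →
           ⟨ x ≔ y ⊖ z , s ⟩⇓[ 1 ] setReg s x (reg s y ∸ reg s z)
  load   : ∀ {s x y} →
           ⟨ x ≔mem[ y ] , s ⟩⇓[ 1 ] setReg s x (mem s (reg s y))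
  store  : ∀ {s x y} →
           ⟨ mem[ x ]≔ y , s ⟩⇓[ 1 ] setMem s (reg s x) (reg s y)
  skip   : ∀ {s} → ⟨ skip , s ⟩⇓[ 1 ] s
  seq    : ∀ {s s′ s″ c d t u} →
           ⟨ c , s ⟩⇓[ t ] s′ → ⟨ d , s′ ⟩⇓[ u ] s″ →
           ⟨ c ⨾ d , s ⟩⇓[ t + u ] s″
  if-nz  : ∀ {s s′ x c d t} → reg s x ≢ 0 → ⟨ c , s ⟩⇓[ t ] s′ →
           ⟨ ifnz x then c else d , s ⟩⇓[ suc t ] s′
  if-z   : ∀ {s s′ x c d t} → reg s x ≡ 0 → ⟨ d , s ⟩⇓[ t ] s′ →
           ⟨ ifnz x then c else d , s ⟩⇓[ suc t ] s′
  while-nz : ∀ {s s′ s″ x c t u} → reg s x ≢ 0 →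
             ⟨ c , s ⟩⇓[ t ] s′ → ⟨ whilenz x loop c , s′ ⟩⇓[ u ] s″ →
             ⟨ whilenz x loop c , s ⟩⇓[ suc (t + u) ] s″
  while-z  : ∀ {s x c} → reg s x ≡ 0 → ⟨ whilenz x loop c , s ⟩⇓[ 1 ] s

contents : List ℕ → ℕ → ℕ
contents []       _       = 0
contents (w ∷ _)  zero    = w
contents (_ ∷ ws) (suc a) = contents ws a

-- The input is in memory from address 0 on, its length in register 0;
-- the answer is read off register 0.
initial : List ℕ → State
initial ws = state ((λ _ → 0) [ 0 ↦ length ws ]) (contents ws)

output : State → ℕ
output s = reg s 0

-- Every polynomial in N is bounded by some c * N ^ d + c.  Nothing is
-- required of the program on inputs violating the promise.
PolyTimeDecidable : {I : Set} (encode : I → List ℕ)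
                    (Promise Yes : I → Set) → Set
PolyTimeDecidable {I} encode Promise Yes =
  ∃[ prog ] ∃[ c ] ∃[ d ] ∀ (x : I) → Promise x →
    ∃[ t ] ∃[ s ]
      ( ⟨ prog , initial (encode x) ⟩⇓[ t ] s
      × t ≤ c * length (encode x) ^ d + c
      × ((output s ≡ 1 × Yes x) ⊎ (output s ≡ 0 × ¬ Yes x)))

------------------------------------------------------------------------
-- The decision problem

record Instance : Set where
  field
    {n m}   : ℕ
    graph   : Graph n
    cliques : Fin m → Subset n

open Instance public

bit : Bool → ℕ
bit false = 0
bit true  = 1

matrix : ∀ {a b} → (Fin a → Fin b → Bool) → List ℕ
matrix M = concat (tabulate λ i → tabulate λ j → bit (M i j))

-- The numbers of vertices and of cliques, the adjacency matrix, and the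
-- clique-vertex incidence matrix, by rows.  When the cliques partition the
-- vertices into α(G) parts, no word exceeds the length of the encoding, so
-- that length is polynomially related to the size in bits.
encode : Instance → List ℕ
encode x = n x ∷ m x ∷ matrix (adj (graph x)) ++ matrix (λ j v → lookup (cliques x j) v)

ValidInput : ℕ → Instance → Set
ValidInput p x =
    K[_]-Free (graph x) p
  × SemiPerfect (graph x)
  × IsCliquePartition (graph x) (cliques x)
  × Isα (graph x) (m x)

GapAtMost : ℕ → Instance → Set
GapAtMost k x = ∃[ g ] (Isμα (graph x) g × g ≤ k)

{-# OPTIONS --safe #-}
module Submission where

-- Let the vertices be partitioned into α(G) cliques.  An independent set meets
-- each clique at most once, so the gap exceeds k iff some maximal independent
-- set S misses k + 1 of the cliques.  Each of those has fewer than p vertices,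
-- each with a neighbour in S; so (k + 1) * p vertices of S, repetitions
-- allowed, dominate k + 1 of the cliques.  Conversely, any independent tuple
-- dominating k + 1 cliques extends to a maximal independent set missing them.
-- For fixed p and k this is a first-order sentence about the vertices and the
-- cliques, and a fixed sentence is checked in polynomial time by nested loops.

open import Defs
open import Data.Bool.Base using (Bool; true; false; T; if_then_else_)
open import Data.Bool.Properties using (T?)
open import Data.Empty using (⊥-elim)
open import Data.Fin.Base using (Fin; zero; suc; toℕ; fromℕ<; inject≤; splitAt; join; combine; remQuot)
open import Data.Fin.Properties
  using (toℕ<n; toℕ-fromℕ<; toℕ-injective; injective⇒≤; suc-injective; inject≤-injective; any?; all?;
         splitAt-join; join-splitAt; remQuot-combine)
  renaming (_≟_ to _≟ᶠ_)
open import Data.Fin.Subset using (Subset; _∈_; _∉_; _⊆_; _⊃_; _∪_; ⁅_⁆; ⊥; ∣_∣)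
open import Data.Fin.Subset.Induction using (⊃-wellFounded)
open import Data.Fin.Subset.Properties
  using (_∈?_; p⊆p∪q; q⊆p∪q; x∈p∪q⁻; x∈p∩q⁺; x∈⁅x⁆; x∈⁅y⁆⇒x≡y; ∉⊥; ∣⊥∣≡0; ∣p∣≤n; anySubset?)
open import Data.List.Base using (List; []; _∷_; _++_; length; tabulate; replicate)
open import Data.List.Properties using (length-++; length-tabulate; ++-assoc; ++-identityʳ)
import Data.List.Membership.Propositional as List
open import Data.List.Relation.Unary.All using (All; []; _∷_)
import Data.List.Relation.Unary.All as All
open import Data.List.Relation.Unary.Any using (here; there)
open import Data.Nat.Base
open import Data.Nat.Properties hiding (suc-injective)
open import Data.Product.Base using (Σ; ∃-syntax; _×_; _,_; proj₁; proj₂)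
open import Data.Sum.Base using (_⊎_; inj₁; inj₂; [_,_]′)
import Data.Sum.Base as Sum
open import Data.Sum.Properties using (inj₁-injective; inj₂-injective)
open import Data.Unit.Base using (⊤; tt)
open import Data.Vec.Base using ([]; _∷_; here; there; lookup)
import Data.Vec.Base as Vec
import Data.Vec.Functional as Vector
open import Data.Vec.Properties using (lookup⇒[]=; []=⇒lookup; lookup∘tabulate)
open import Function.Base using (_∘_; id)
open import Function.Bundles using (_⇔_; mk⇔; Equivalence)
open import Function.Definitions using (Injective)
open import Induction.WellFounded using (Acc; acc)
open import Level using (0ℓ)
open import Relation.Binary.PropositionalEquality
open import Relation.Nullary
open import Relation.Nullary.Decidable
  using (_×-dec_; _→-dec_; ¬?; map′; dec-true; dec-false; False; toWitnessFalse; decidable-stable)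
open import Relation.Unary using (Pred; Decidable)

open Equivalence using (to; from)

-- Running programs within a time bound

Run : Cmd → State → ℕ → (State → Set) → Set
Run c s b Q = ∃[ t ] ∃[ s′ ] (⟨ c , s ⟩⇓[ t ] s′ × t ≤ b × Q s′)

module _ {s : State} where

  run-const : ∀ {Q : State → Set} {x c} → Q (setReg s x c) → Run (x ≔const c) s 1 Q
  run-const q = _ , _ , const , ≤-refl , q

  run-add : ∀ {Q : State → Set} {x y z} → Q (setReg s x (reg s y + reg s z)) → Run (x ≔ y ⊕ z) s 1 Q
  run-add q = _ , _ , add , ≤-refl , q

  run-sub : ∀ {Q : State → Set} {x y z} → Q (setReg s x (reg s y ∸ reg s z)) → Run (x ≔ y ⊖ z) s 1 Q
  run-sub q = _ , _ , sub , ≤-refl , q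

  run-load : ∀ {Q : State → Set} {x y} → Q (setReg s x (mem s (reg s y))) → Run (x ≔mem[ y ]) s 1 Q
  run-load q = _ , _ , load , ≤-refl , q

  run-skip : ∀ {Q : State → Set} → Q s → Run skip s 1 Q
  run-skip q = _ , _ , skip , ≤-refl , q

  run-seq : ∀ {c d b₁ b₂ Q} → Run c s b₁ (λ s′ → Run d s′ b₂ Q) → Run (c ⨾ d) s (b₁ + b₂) Q
  run-seq (_ , _ , p , t≤ , _ , _ , p′ , t′≤ , q) = _ , _ , seq p p′ , +-mono-≤ t≤ t′≤ , q

  run-weaken : ∀ {c b₁ b₂} {Q R : State → Set} → b₁ ≤ b₂ → (∀ {s′} → Q s′ → R s′) → Run c s b₁ Q → Run c s b₂ R
  run-weaken b≤ f (_ , _ , p , t≤ , q) = _ , _ , p , ≤-trans t≤ b≤ , f q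

  run-if : ∀ {x c d b Q} → (reg s x ≢ 0 → Run c s b Q) → (reg s x ≡ 0 → Run d s b Q) →
           Run (ifnz x then c else d) s (suc b) Q
  run-if {x} nz z with reg s x ≟ 0
  ... | yes eq = let _ , _ , p , t≤ , q = z eq in _ , _ , if-z eq p , s≤s t≤ , q
  ... | no neq = let _ , _ , p , t≤ , q = nz neq in _ , _ , if-nz neq p , s≤s t≤ , q

-- The invariant is indexed by the number of rounds left, which register `x` holds, so recursion on
-- that number gives termination and the time bound at once. A round costs `b` plus one step for the
-- test; the final `1` is the failing test.
run-countdown : ∀ {x c b} (I : ℕ → State → Set) →
  (∀ {r s} → I r s → reg s x ≡ r) →
  (∀ {r s} → I (suc r) s → Run c s b (I r)) →
  ∀ r {s} → I r s → Run (whilenz x loop c) s (r * suc b + 1) (I 0)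
run-countdown I count step zero i = _ , _ , while-z (count i) , ≤-refl , i
run-countdown {b = b} I count step (suc r) i =
  let _ , _ , p , t≤ , i′      = step i
      _ , _ , p′ , t′≤ , i″ = run-countdown I count step r i′
      nonzero = λ eq → 1+n≢0 (trans (sym (count i)) eq)
  in _ , _ , while-nz nonzero p p′ ,
     s≤s (≤-trans (+-mono-≤ t≤ t′≤) (≤-reflexive (sym (+-assoc b (r * suc b) 1)))) , i″

-- Polynomially bounded functions

-- For nonzero `N` the power `N ^ d` is monotone in `d`, so a single monomial can bound a sum of
-- monomials.
PolyBounded : (ℕ → ℕ) → Set
PolyBounded f = ∃[ c ] ∃[ d ] ∀ N → .{{NonZero N}} → f N ≤ c * N ^ d

poly-const : ∀ c → PolyBounded (λ _ → c)
poly-const c = c , 0 , λ _ → ≤-reflexive (sym (*-identityʳ c))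

poly-+ : ∀ {f g} → PolyBounded f → PolyBounded g → PolyBounded (λ N → f N + g N)
poly-+ {f} {g} (c , d , f≤) (c′ , d′ , g≤) = c + c′ , d + d′ , λ N → begin
  f N + g N                             ≤⟨ +-mono-≤ (f≤ N) (g≤ N) ⟩
  c * N ^ d + c′ * N ^ d′               ≤⟨ +-mono-≤ (*-monoʳ-≤ c (^-monoʳ-≤ N (m≤m+n d d′)))
                                                    (*-monoʳ-≤ c′ (^-monoʳ-≤ N (m≤n+m d′ d))) ⟩
  c * N ^ (d + d′) + c′ * N ^ (d + d′)  ≡⟨ *-distribʳ-+ (N ^ (d + d′)) c c′ ⟨
  (c + c′) * N ^ (d + d′)               ∎
  where open ≤-Reasoning

poly-* : ∀ {f} → PolyBounded f → PolyBounded (λ N → N * f N)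
poly-* {f} (c , d , f≤) = c , suc d , λ N → begin
  N * f N          ≤⟨ *-monoʳ-≤ N (f≤ N) ⟩
  N * (c * N ^ d)  ≡⟨ *-assoc N c (N ^ d) ⟨
  N * c * N ^ d    ≡⟨ cong (_* N ^ d) (*-comm N c) ⟩
  c * N * N ^ d    ≡⟨ *-assoc c N (N ^ d) ⟩
  c * N ^ suc d    ∎
  where open ≤-Reasoning

-- First-order formulas over the two-sorted structure of vertices and cliques

data Sort : Set where
  vertex clique : Sort

Context : Set
Context = List Sort

Var : Sort → Context → Set
Var s Γ = s List.∈ Γ

infix  8 _∼_ _ε_ _≠̇_
infix  7 ¬̇_
infixr 6 _∧̇_

data Formula (Γ : Context) : Set where
  ⊤̇   : Formula Γ
  _∼_ : (u v : Var vertex Γ) → Formula Γ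
  _ε_ : (v : Var vertex Γ) (j : Var clique Γ) → Formula Γ
  _≠̇_ : (i j : Var clique Γ) → Formula Γ
  ¬̇_  : Formula Γ → Formula Γ
  _∧̇_ : (φ ψ : Formula Γ) → Formula Γ
  ∃̇   : ∀ s → Formula (s ∷ Γ) → Formula Γ

module Semantics (x : Instance) where

  size : Sort → ℕ
  size vertex = n x
  size clique = m x

  Env : Context → Set
  Env = All (Fin ∘ size)

  ⟦_⟧ : ∀ {Γ} → Formula Γ → Env Γ → Set
  ⟦ ⊤̇ ⟧     ρ = ⊤
  ⟦ u ∼ v ⟧ ρ = Adj (graph x) (All.lookup ρ u) (All.lookup ρ v)
  ⟦ v ε j ⟧ ρ = All.lookup ρ v ∈ cliques x (All.lookup ρ j)
  ⟦ i ≠̇ j ⟧ ρ = All.lookup ρ i ≢ All.lookup ρ j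
  ⟦ ¬̇ φ ⟧   ρ = ¬ ⟦ φ ⟧ ρ
  ⟦ φ ∧̇ ψ ⟧ ρ = ⟦ φ ⟧ ρ × ⟦ ψ ⟧ ρ
  ⟦ ∃̇ s φ ⟧ ρ = ∃[ a ] ⟦ φ ⟧ (a ∷ ρ)

-- Compiling formulas

-- Register 0 is for results; registers 1 to 5 hold 1, the number n of
-- vertices, the number of cliques, and the addresses of the two matrices.
-- Each variable in scope has four registers: its value a, the offset a * n of
-- row a in a matrix, the number of values left to try, and a sum of results,
-- which is nonzero iff a witness has been found.
frame : Context → ℕ
frame []      = 6
frame (_ ∷ Γ) = 4 + frame Γ

value : ∀ {s Γ} → Var s Γ → ℕ
value {Γ = _ ∷ Γ} (here _)  = frame Γ
value {Γ = _ ∷ Γ} (there v) = value v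

sizeReg : Sort → ℕ
sizeReg vertex = 2
sizeReg clique = 3

-- `u` selects the row. Its stored offset replaces the multiplication that the machine does not
-- have.
fetch : ∀ {s t Γ} → ℕ → Var s Γ → Var t Γ → Cmd
fetch matrixReg u v =
  0 ≔ suc (value u) ⊕ value v ⨾ 0 ≔ matrixReg ⊕ 0 ⨾ 0 ≔mem[ 0 ]

compile : ∀ {Γ} → Formula Γ → Cmd
advance : ∀ {Γ s} → Formula (s ∷ Γ) → Cmd

compile ⊤̇       = 0 ≔const 1
compile (u ∼ v) = fetch 4 u v
compile (v ε j) = fetch 5 j v
-- Truncated subtraction also gives zero when the first value is smaller, so a zero is checked in
-- the other direction.
compile (i ≠̇ j) = 0 ≔ value i ⊖ value j ⨾ (ifnz 0 then skip else 0 ≔ value j ⊖ value i)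
-- Register 1 holds 1, so this sends zero to 1 and every nonzero value to 0.
compile (¬̇ φ)   = compile φ ⨾ 0 ≔ 1 ⊖ 0
compile (φ ∧̇ ψ) = compile φ ⨾ (ifnz 0 then compile ψ else skip)
compile {Γ} (∃̇ s φ) =
  let b = frame Γ in
  -- Adding a register known to be zero serves as a move: `b` here, the exhausted counter `2 + b`
  -- after the loop.
  b ≔const 0 ⨾ suc b ≔const 0 ⨾ (2 + b) ≔ sizeReg s ⊕ b ⨾ (3 + b) ≔const 0 ⨾
  (whilenz (2 + b) loop advance φ) ⨾
  0 ≔ (3 + b) ⊕ (2 + b)

advance {Γ} φ =
  let b = frame Γ in
  compile φ ⨾ (3 + b) ≔ (3 + b) ⊕ 0 ⨾ b ≔ b ⊕ 1 ⨾ suc b ≔ suc b ⊕ 2 ⨾ (2 + b) ≔ (2 + b) ⊖ 1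

-- The adjacency matrix starts at address 2 and the incidence matrix at 2 + n². The square is formed
-- by adding n to register 5 n times.
setup : Cmd
setup = 1 ≔const 1 ⨾ 4 ≔const 2 ⨾ 5 ≔const 2 ⨾ 0 ≔const 0 ⨾ 2 ≔mem[ 0 ] ⨾ 3 ≔mem[ 1 ] ⨾ 0 ≔mem[ 0 ] ⨾
        (whilenz 0 loop (5 ≔ 5 ⊕ 2 ⨾ 0 ≔ 0 ⊖ 1))

cost : ∀ {Γ} → Formula Γ → ℕ → ℕ
cost ⊤̇       N = 1
cost (_ ∼ _) N = 3
cost (_ ε _) N = 3
cost (_ ≠̇ _) N = 3
cost (¬̇ φ)   N = cost φ N + 1
-- One step is the test; the other makes the bound for the two branches also cover `skip`.
cost (φ ∧̇ ψ) N = cost φ N + (2 + cost ψ N)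
-- Four initial assignments; at most `N` rounds, each with a test and four updates; then the failing
-- test and the final move.
cost (∃̇ _ φ) N = 4 + (N * suc (cost φ N + 4) + 1 + 1)

cost-poly : ∀ {Γ} (φ : Formula Γ) → PolyBounded (cost φ)
cost-poly ⊤̇       = poly-const 1
cost-poly (_ ∼ _) = poly-const 3
cost-poly (_ ε _) = poly-const 3
cost-poly (_ ≠̇ _) = poly-const 3
cost-poly (¬̇ φ)   = poly-+ (cost-poly φ) (poly-const 1)
cost-poly (φ ∧̇ ψ) = poly-+ (cost-poly φ) (poly-+ (poly-const 2) (cost-poly ψ))
cost-poly (∃̇ _ φ) =
  poly-+ (poly-const 4)
    (poly-+ (poly-+ (poly-* (poly-+ (poly-const 1) (poly-+ (cost-poly φ) (poly-const 4)))) (poly-const 1))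
            (poly-const 1))

-- Memory and registers

contents-++ : ∀ (xs : List ℕ) {ys} a → contents (xs ++ ys) (length xs + a) ≡ contents ys a
contents-++ []       a = refl
contents-++ (_ ∷ xs) a = contents-++ xs a

contents-tabulate : ∀ {b} (f : Fin b → ℕ) {ys} i → contents (tabulate f ++ ys) (toℕ i) ≡ f i
contents-tabulate f zero    = refl
contents-tabulate f (suc i) = contents-tabulate (f ∘ suc) i

length-matrix : ∀ {a b} (M : Fin a → Fin b → Bool) → length (matrix M) ≡ a * b
length-matrix {zero}      M = refl
length-matrix {suc a} {b} M =
  trans (length-++ (tabulate (bit ∘ M zero)))
        (cong₂ _+_ (length-tabulate (bit ∘ M zero)) (length-matrix (M ∘ suc)))

-- The tail `ys` allows for what follows a matrix in memory, as the incidence matrix follows the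
-- adjacency matrix.
contents-matrix : ∀ {a b} (M : Fin a → Fin b → Bool) {ys} i j →
                  contents (matrix M ++ ys) (toℕ i * b + toℕ j) ≡ bit (M i j)
contents-matrix {suc a} {b} M {ys} i j
  rewrite ++-assoc (tabulate (bit ∘ M zero)) (matrix (M ∘ suc)) ys = entry i
  where
  row₀ = tabulate (bit ∘ M zero)
  rest = matrix (M ∘ suc) ++ ys

  entry : ∀ i → contents (row₀ ++ rest) (toℕ i * b + toℕ j) ≡ bit (M i j)
  entry zero    = contents-tabulate (bit ∘ M zero) j
  entry (suc i) = begin
    contents (row₀ ++ rest) (b + toℕ i * b + toℕ j)
      ≡⟨ cong (contents (row₀ ++ rest)) (+-assoc b _ _) ⟩
    contents (row₀ ++ rest) (b + (toℕ i * b + toℕ j))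
      ≡⟨ cong (λ l → contents (row₀ ++ rest) (l + (toℕ i * b + toℕ j))) (length-tabulate (bit ∘ M zero)) ⟨
    contents (row₀ ++ rest) (length row₀ + (toℕ i * b + toℕ j))
      ≡⟨ contents-++ row₀ _ ⟩
    contents rest (toℕ i * b + toℕ j)
      ≡⟨ contents-matrix (M ∘ suc) i j ⟩
    bit (M (suc i) j) ∎
    where open ≡-Reasoning

put-≡ : ∀ (f : ℕ → ℕ) x {v} → (f [ x ↦ v ]) x ≡ v
put-≡ f x rewrite dec-true (x ≟ x) refl = refl

put-≢ : ∀ (f : ℕ → ℕ) {x y v} → y ≢ x → (f [ x ↦ v ]) y ≡ f y
put-≢ f {x} {y} y≢x rewrite dec-false (y ≟ x) y≢x = refl

0<value : ∀ {s Γ} (v : Var s Γ) → 0 < value v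
0<value {Γ = _ ∷ Γ} (here _)  = 0<frame Γ
  where
  0<frame : ∀ Γ → 0 < frame Γ
  0<frame []      = z<s
  0<frame (_ ∷ _) = z<s
0<value {Γ = _ ∷ Γ} (there v) = 0<value v

value<frame : ∀ {s Γ} (v : Var s Γ) → suc (value v) < frame Γ
value<frame {Γ = _ ∷ Γ} (here _)  = +-monoˡ-< (frame Γ) {1} {4} (s<s z<s)
value<frame {Γ = _ ∷ Γ} (there v) = <-≤-trans (value<frame v) (m≤n+m _ 4)

6≤frame : ∀ Γ → 6 ≤ frame Γ
6≤frame []      = ≤-refl
6≤frame (_ ∷ Γ) = ≤-trans (6≤frame Γ) (m≤n+m _ 4)

-- This is what a compiled subformula preserves. Register 0 is excepted because it carries results,
-- and registers from `b` on belong to inner variables.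
record Agree (b : ℕ) (s s′ : State) : Set where
  constructor agree
  field
    same-mem : mem s′ ≡ mem s
    same-reg : ∀ {y} → 0 < y → y < b → reg s′ y ≡ reg s y

open Agree

agree-refl : ∀ {b s} → Agree b s s
agree-refl = agree refl (λ _ _ → refl)

agree-trans : ∀ {b s s′ s″} → Agree b s s′ → Agree b s′ s″ → Agree b s s″
agree-trans p q = agree (trans (same-mem q) (same-mem p))
                        (λ 0<y y<b → trans (same-reg q 0<y y<b) (same-reg p 0<y y<b))

agree-≤ : ∀ {b b′ s s′} → b′ ≤ b → Agree b s s′ → Agree b′ s s′
agree-≤ b′≤b p = agree (same-mem p) (λ 0<y y<b′ → same-reg p 0<y (<-≤-trans y<b′ b′≤b))

agree-setReg₀ : ∀ {b s s′ v} → Agree b s s′ → Agree b s (setReg s′ 0 v)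
agree-setReg₀ {s′ = s′} p = agree-trans p (agree refl λ 0<y _ → put-≢ (reg s′) (>⇒≢ 0<y))

agree-setReg : ∀ {b s s′ v} i → Agree b s s′ → Agree b s (setReg s′ (i + b) v)
agree-setReg {b} {s′ = s′} i p =
  agree-trans p (agree refl λ _ y<b → put-≢ (reg s′) (<⇒≢ (<-≤-trans y<b (m≤n+m b i))))

-- For literal offsets `i` and `j` the side condition is settled by evaluation.
put-offset : ∀ (f : ℕ → ℕ) b i j {i≢j : False (i ≟ j)} {v} → (f [ j + b ↦ v ]) (i + b) ≡ f (i + b)
put-offset f b i j {i≢j} = put-≢ f (toWitnessFalse i≢j ∘ +-cancelʳ-≡ b i j)

-- Any nonzero value counts as true, because a quantifier leaves a sum of results and not a bit.
Flags : Set → ℕ → Set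
Flags P v = (v ≢ 0 × P) ⊎ (v ≡ 0 × ¬ P)

flags-⇔ : ∀ {P Q v} → P ⇔ Q → Flags P v → Flags Q v
flags-⇔ P⇔Q = Sum.map (λ (z , p) → z , to P⇔Q p) (λ (z , ¬p) → z , ¬p ∘ from P⇔Q)

flags-true : ∀ {P v} → Flags P v → v ≢ 0 → P
flags-true (inj₁ (_ , p))   _   = p
flags-true (inj₂ (v≡0 , _)) v≢0 = ⊥-elim (v≢0 v≡0)

flags-false : ∀ {P v} → Flags P v → v ≡ 0 → ¬ P
flags-false (inj₁ (v≢0 , _)) v≡0 = ⊥-elim (v≢0 v≡0)
flags-false (inj₂ (_ , ¬p))  _   = ¬p

flags-bit : ∀ b → Flags (T b) (bit b)
flags-bit true  = inj₁ ((λ ()) , tt)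
flags-bit false = inj₂ (refl , λ ())

flags-¬ : ∀ {P v} → Flags P v → Flags (¬ P) (1 ∸ v)
flags-¬ {v = zero}  (inj₁ (z , _)) = ⊥-elim (z refl)
flags-¬ {v = suc v} (inj₁ (_ , p)) = inj₂ (0∸n≡0 v , λ ¬p → ¬p p)
flags-¬             (inj₂ (refl , ¬p)) = inj₁ ((λ ()) , ¬p)

Found : ∀ {N} → (Fin N → Set) → ℕ → ℕ → Set
Found P i = Flags (∃[ a ] (toℕ a < i × P a))

-- A sum of naturals vanishes only if both summands do, so addition acts as disjunction.
found-suc : ∀ {N} {P : Fin N → Set} {i v w} (a : Fin N) → toℕ a ≡ i →
            Found P i v → Flags (P a) w → Found P (suc i) (v + w)
found-suc {v = v} a refl (inj₁ (v≢0 , a′ , a′<i , p)) _ =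
  inj₁ (v≢0 ∘ m+n≡0⇒m≡0 v , a′ , m<n⇒m<1+n a′<i , p)
found-suc {v = v} a refl (inj₂ _) (inj₁ (w≢0 , p)) =
  inj₁ (w≢0 ∘ m+n≡0⇒n≡0 v , a , n<1+n _ , p)
found-suc {P = P} a refl (inj₂ (refl , ¬p)) (inj₂ (refl , ¬q)) = inj₂ (refl , none)
  where
  none : ¬ (∃[ a′ ] (toℕ a′ < suc (toℕ a) × P a′))
  none (a′ , s≤s a′≤a , p) with m≤n⇒m<n∨m≡n a′≤a
  ... | inj₁ a′<a = ¬p (a′ , a′<a , p)
  ... | inj₂ a′≡a = ¬q (subst P (toℕ-injective a′≡a) p)

-- Correctness and running time of the compiled formulas

module Correctness (x : Instance) where

  open Semantics x

  -- The index `i` counts the completed rounds of the loop in `setup`; at `i = n x` register 5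
  -- points to the incidence matrix.
  record Loaded (i : ℕ) (s : State) : Set where
    field
      memory : mem s ≡ contents (encode x)
      reg₁   : reg s 1 ≡ 1
      reg₂   : reg s 2 ≡ n x
      reg₃   : reg s 3 ≡ m x
      reg₄   : reg s 4 ≡ 2
      reg₅   : reg s 5 ≡ 2 + i * n x

  open Loaded

  Stores : ∀ {Γ} → Env Γ → State → Set
  Stores {Γ} ρ s = ∀ {t} (v : Var t Γ) →
    reg s (value v) ≡ toℕ (All.lookup ρ v) × reg s (suc (value v)) ≡ toℕ (All.lookup ρ v) * n x

  loaded-agree : ∀ {b i s s′} → 6 ≤ b → Agree b s s′ → Loaded i s → Loaded i s′
  loaded-agree 6≤b p l = record
    { memory = trans (same-mem p) (memory l)
    ; reg₁   = trans (kept 1 z<s (s<s z<s)) (reg₁ l)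
    ; reg₂   = trans (kept 2 z<s (s<s (s<s z<s))) (reg₂ l)
    ; reg₃   = trans (kept 3 z<s (s<s (s<s (s<s z<s)))) (reg₃ l)
    ; reg₄   = trans (kept 4 z<s (s<s (s<s (s<s (s<s z<s))))) (reg₄ l)
    ; reg₅   = trans (kept 5 z<s (s<s (s<s (s<s (s<s (s<s z<s)))))) (reg₅ l)
    }
    where
    kept : ∀ y → 0 < y → y < 6 → _
    kept y 0<y y<6 = same-reg p {y} 0<y (<-≤-trans y<6 6≤b)

  stores-agree : ∀ {Γ s s′} (ρ : Env Γ) → Agree (frame Γ) s s′ → Stores ρ s → Stores ρ s′
  stores-agree ρ p st v =
    trans (same-reg p (0<value v) (<-trans (n<1+n _) (value<frame v))) (proj₁ (st v)) ,
    trans (same-reg p z<s (value<frame v)) (proj₂ (st v))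

  reg-size : ∀ {i s} t → Loaded i s → reg s (sizeReg t) ≡ size t
  reg-size vertex = reg₂
  reg-size clique = reg₃

  contents-adj : ∀ u v → contents (encode x) (2 + (toℕ u * n x + toℕ v)) ≡ bit (adj (graph x) u v)
  contents-adj = contents-matrix (adj (graph x))

  contents-incidence : ∀ j v →
    contents (encode x) (2 + n x * n x + (toℕ j * n x + toℕ v)) ≡ bit (lookup (cliques x j) v)
  contents-incidence j v = begin
    contents (A ++ I) (n x * n x + (toℕ j * n x + toℕ v))
      ≡⟨ cong (λ l → contents (A ++ I) (l + (toℕ j * n x + toℕ v))) (length-matrix (adj (graph x))) ⟨
    contents (A ++ I) (length A + (toℕ j * n x + toℕ v))
      ≡⟨ contents-++ A _ ⟩
    contents I (toℕ j * n x + toℕ v)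
      ≡⟨ cong (λ xs → contents xs (toℕ j * n x + toℕ v)) (++-identityʳ I) ⟨
    contents (I ++ []) (toℕ j * n x + toℕ v)
      ≡⟨ contents-matrix (λ j v → lookup (cliques x j) v) j v ⟩
    bit (lookup (cliques x j) v) ∎
    where
    open ≡-Reasoning
    A = matrix (adj (graph x))
    I = matrix (λ j v → lookup (cliques x j) v)

  T-lookup : ∀ {N} {S : Subset N} {v} → T (lookup S v) ⇔ v ∈ S
  T-lookup {S = S} {v} = mk⇔
    (λ t → lookup⇒[]= v S (T⇒≡true t))
    (λ v∈S → subst T (sym ([]=⇒lookup v∈S)) tt)
    where
    T⇒≡true : ∀ {b} → T b → b ≡ true
    T⇒≡true {true} _ = refl

  Evaluates : ∀ {Γ} → Formula Γ → Env Γ → State → State → Set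
  Evaluates {Γ} φ ρ s s′ = Agree (frame Γ) s s′ × Flags (⟦ φ ⟧ ρ) (reg s′ 0)

  fetch-correct : ∀ {Γ t t′ matrixReg base b P s} (ρ : Env Γ) (u : Var t Γ) (v : Var t′ Γ) →
    0 < matrixReg → mem s ≡ contents (encode x) → reg s matrixReg ≡ base → Stores ρ s →
    contents (encode x) (base + (toℕ (All.lookup ρ u) * n x + toℕ (All.lookup ρ v))) ≡ bit b →
    T b ⇔ P →
    Run (fetch matrixReg u v) s 3 (λ s′ → Agree (frame Γ) s s′ × Flags P (reg s′ 0))
  fetch-correct {Γ = Γ} {matrixReg = r} {b = b} {s = s} ρ u v 0<r mem≡ reg≡ st entry b⇔P =
    run-seq {b₁ = 1} (run-add (run-seq {b₁ = 1} (run-add (run-load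
      ( agree-setReg₀ (agree-setReg₀ (agree-setReg₀ agree-refl))
      , flags-⇔ b⇔P (subst (Flags (T b)) (sym loaded) (flags-bit b)))))))
    where
    f₁ = reg s [ 0 ↦ reg s (suc (value u)) + reg s (value v) ]

    loaded : mem s (f₁ r + f₁ 0) ≡ bit b
    loaded rewrite put-≢ (reg s) {v = f₁ 0} (>⇒≢ 0<r) | mem≡ | reg≡ | proj₂ (st u) | proj₁ (st v) = entry

  -- By induction on the formula. Each part leaves the registers of the variables in scope
  -- unchanged, so the next part starts from the same environment.
  compile-correct : ∀ {Γ N s} (φ : Formula Γ) (ρ : Env Γ) → (∀ t → size t ≤ N) →
    Loaded (n x) s → Stores ρ s → Run (compile φ) s (cost φ N) (Evaluates φ ρ s)

  -- Agreement is claimed only below the outer frame, since the round changes the four registers of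
  -- the quantified variable; these are described one by one.
  advance-correct : ∀ {Γ N t s} (φ : Formula (t ∷ Γ)) {ρ : Env Γ} (a : Fin (size t)) → (∀ t → size t ≤ N) →
    let b = frame Γ in
    Loaded (n x) s → Stores (a ∷ ρ) s →
    Run (advance φ) s (cost φ N + 4) (λ s′ →
      Agree b s s′ ×
      reg s′ b ≡ suc (reg s b) ×
      reg s′ (1 + b) ≡ n x + reg s (1 + b) ×
      reg s′ (2 + b) ≡ reg s (2 + b) ∸ 1 ×
      ∃[ w ] (Flags (⟦ φ ⟧ (a ∷ ρ)) w × reg s′ (3 + b) ≡ reg s (3 + b) + w))

  compile-correct ⊤̇ ρ bound l st = run-const (agree-setReg₀ agree-refl , inj₁ ((λ ()) , tt))
  compile-correct (u ∼ v) ρ bound l st =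
    fetch-correct ρ u v z<s (memory l) (reg₄ l) st (contents-adj _ _) (mk⇔ id id)
  compile-correct (v ε j) ρ bound l st =
    fetch-correct ρ j v z<s (memory l) (reg₅ l) st (contents-incidence _ _) T-lookup
  compile-correct {s = s} (i ≠̇ j) ρ bound l st =
    run-seq {b₁ = 1} (run-sub (run-if
      (λ i∸j≢0 → run-skip
        ( agree-setReg₀ agree-refl
        , inj₁ (i∸j≢0 , λ eq → i∸j≢0 (trans (cong₂ _∸_ (valᵢ eq) (proj₁ (st j))) (n∸n≡0 (toℕ (All.lookup ρ j)))))))
      (λ i∸j≡0 → run-sub
        ( agree-setReg₀ (agree-setReg₀ agree-refl)
        , subst (Flags _) (sym kept) (flag (subst (_≡ 0) (cong₂ _∸_ (proj₁ (st i)) (proj₁ (st j))) i∸j≡0))))))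
    where
    valᵢ : All.lookup ρ i ≡ All.lookup ρ j → reg s (value i) ≡ toℕ (All.lookup ρ j)
    valᵢ eq = trans (proj₁ (st i)) (cong toℕ eq)

    kept : ∀ {w} → (reg s [ 0 ↦ w ]) (value j) ∸ (reg s [ 0 ↦ w ]) (value i) ≡
           toℕ (All.lookup ρ j) ∸ toℕ (All.lookup ρ i)
    kept = cong₂ _∸_ (trans (put-≢ (reg s) (>⇒≢ (0<value j))) (proj₁ (st j)))
                     (trans (put-≢ (reg s) (>⇒≢ (0<value i))) (proj₁ (st i)))

    flag : ∀ {N} {a b : Fin N} → toℕ a ∸ toℕ b ≡ 0 → Flags (a ≢ b) (toℕ b ∸ toℕ a)
    flag {a = a} {b} a∸b≡0 with toℕ b ∸ toℕ a ≟ 0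
    ... | yes b∸a≡0 = inj₂ (b∸a≡0 , λ a≢b → a≢b (toℕ-injective (≤-antisym (m∸n≡0⇒m≤n a∸b≡0) (m∸n≡0⇒m≤n b∸a≡0))))
    ... | no b∸a≢0  = inj₁ (b∸a≢0 , λ { refl → b∸a≢0 a∸b≡0 })
  compile-correct {Γ} (¬̇ φ) ρ bound l st =
    run-seq (run-weaken ≤-refl (λ {s′} (p , f) → run-sub
      ( agree-setReg₀ p
      , subst (λ one → Flags _ (one ∸ reg s′ 0)) (sym (reg₁ (loaded-agree (6≤frame Γ) p l))) (flags-¬ f)))
    (compile-correct φ ρ bound l st))
  compile-correct {Γ} {N} (φ ∧̇ ψ) ρ bound l st =
    run-seq (run-weaken ≤-refl (λ (p , f) → run-if
      (λ nz → run-weaken (n≤1+n _)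
        (λ (p′ , f′) → agree-trans p p′ , flags-⇔ (mk⇔ (flags-true f nz ,_) proj₂) f′)
        (compile-correct ψ ρ bound (loaded-agree (6≤frame Γ) p l) (stores-agree ρ p st)))
      (λ z → run-weaken (s≤s z≤n) id (run-skip (p , inj₂ (z , flags-false f z ∘ proj₁)))))
    (compile-correct φ ρ bound l st))
  compile-correct {Γ} {N} {s} (∃̇ t φ) ρ bound l st =
    run-seq {b₁ = 1} (run-const (run-seq {b₁ = 1} (run-const (run-seq {b₁ = 1} (run-add (run-seq {b₁ = 1} (run-const
      (run-seq (run-weaken (+-monoˡ-≤ 1 (*-monoˡ-≤ _ (bound t))) finish
        (run-countdown Invariant (λ (_ , _ , _ , _ , left , _) → left) step (size t) started))))))))))
    where
    b = frame Γ

    -- Here `i` values have been tried and `r` remain. The offset has the same form for both sorts,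
    -- because a row has `n x` entries in either matrix.
    Invariant : ℕ → State → Set
    Invariant r s′ = ∃[ i ]
      ( i + r ≡ size t × reg s′ b ≡ i × reg s′ (1 + b) ≡ i * n x × reg s′ (2 + b) ≡ r
      × Found (λ a → ⟦ φ ⟧ (a ∷ ρ)) i (reg s′ (3 + b)) × Agree b s s′)

    s₁ = setReg s b 0
    s₂ = setReg s₁ (1 + b) 0
    s₃ = setReg s₂ (2 + b) (reg s₂ (sizeReg t) + reg s₂ b)
    s₄ = setReg s₃ (3 + b) 0

    agree₂ : Agree b s s₂
    agree₂ = agree-setReg 1 (agree-setReg 0 agree-refl)

    started : Invariant (size t) s₄
    started = 0 , refl
      , trans (put-offset (reg s₃) b 0 3) (trans (put-offset (reg s₂) b 0 2) zeroed)
      , trans (put-offset (reg s₃) b 1 3) (trans (put-offset (reg s₂) b 1 2) (put-≡ (reg s₁) (1 + b)))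
      , trans (put-offset (reg s₃) b 2 3) (trans (put-≡ (reg s₂) (2 + b))
          (trans (cong₂ _+_ (reg-size t (loaded-agree (6≤frame Γ) agree₂ l)) zeroed) (+-identityʳ (size t))))
      , inj₂ (put-≡ (reg s₃) (3 + b) , λ ())
      , agree-setReg 3 (agree-setReg 2 agree₂)
      where
      zeroed : reg s₂ b ≡ 0
      zeroed = trans (put-offset (reg s₁) b 0 1) (put-≡ (reg s) b)

    step : ∀ {r s′} → Invariant (suc r) s′ → Run (advance φ) s′ (cost φ N + 4) (Invariant r)
    step {r} {s′} (i , i+r≡ , val , row , left , found , p) =
      run-weaken ≤-refl
        (λ (p′ , val′ , row′ , left′ , w , f , found′) →
          suc i , trans (sym (+-suc i r)) i+r≡ , trans val′ (cong suc val) , trans row′ (cong (n x +_) row) ,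
          trans left′ (cong (_∸ 1) left) , subst (Found _ (suc i)) (sym found′) (found-suc a a≡i found f) ,
          agree-trans p p′)
        (advance-correct φ a bound (loaded-agree (6≤frame Γ) p l) stores)
      where
      i<size : i < size t
      i<size = subst (i <_) i+r≡ (m<m+n i z<s)
      a = fromℕ< i<size
      a≡i = toℕ-fromℕ< i<size

      stores : Stores (a ∷ ρ) s′
      stores (here refl) = trans val (sym a≡i) , trans row (cong (_* n x) (sym a≡i))
      stores (there v)   = stores-agree ρ p st v

    finish : ∀ {s′} → Invariant 0 s′ → Run (0 ≔ (3 + b) ⊕ (2 + b)) s′ 1 (Evaluates (∃̇ t φ) ρ s)
    finish {s′} (i , i+0≡ , _ , _ , left , found , p) = run-add
      ( agree-setReg₀ p
      , subst (Flags _) (sym (trans (cong (reg s′ (3 + b) +_) left) (+-identityʳ _)))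
          (flags-⇔ (mk⇔ (λ (a , _ , q) → a , q)
                        (λ (a , q) → a , subst (toℕ a <_) (trans (sym i+0≡) (+-identityʳ i)) (toℕ<n a) , q)) found))
  advance-correct {Γ} {N} {t} {s} φ {ρ} a bound l st =
    run-seq (run-weaken ≤-refl tail (compile-correct φ (a ∷ ρ) bound l st))
    where
    b = frame Γ

    tail : ∀ {s₁} → Evaluates φ (a ∷ ρ) s s₁ →
      Run ((3 + b) ≔ (3 + b) ⊕ 0 ⨾ b ≔ b ⊕ 1 ⨾ suc b ≔ suc b ⊕ 2 ⨾ (2 + b) ≔ (2 + b) ⊖ 1) s₁ 4 _
    tail {s₁} (p , f) =
      run-seq {b₁ = 1} (run-add (run-seq {b₁ = 1} (run-add (run-seq {b₁ = 1} (run-add (run-sub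
        ( agree-setReg 2 agree₄
        , trans (put-offset (reg s₄) b 0 2) (trans (put-offset (reg s₃) b 0 1)
            (trans (put-≡ (reg s₂) b) (trans (cong₂ _+_ (trans (put-offset (reg s₁) b 0 3) (kept 0 (s<s z≤n)))
                                                       (reg₁ (loaded-agree 6≤b agree₂ l)))
                                             (+-comm _ 1))))
        , trans (put-offset (reg s₄) b 1 2) (trans (put-≡ (reg s₃) (1 + b))
            (trans (cong₂ _+_ (trans (put-offset (reg s₂) b 1 0) (trans (put-offset (reg s₁) b 1 3) (kept 1 (s<s z<s))))
                              (reg₂ (loaded-agree 6≤b agree₃ l)))
                   (+-comm _ (n x))))
        , trans (put-≡ (reg s₄) (2 + b))
            (cong₂ _∸_ (trans (put-offset (reg s₃) b 2 1) (trans (put-offset (reg s₂) b 2 0)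
                         (trans (put-offset (reg s₁) b 2 3) (kept 2 (s<s (s<s z<s))))))
                       (reg₁ (loaded-agree 6≤b agree₄ l)))
        , reg s₁ 0 , f
        , trans (put-offset (reg s₄) b 3 2) (trans (put-offset (reg s₃) b 3 1)
            (trans (put-offset (reg s₂) b 3 0) (trans (put-≡ (reg s₁) (3 + b))
              (cong (_+ reg s₁ 0) (kept 3 (s<s (s<s (s<s z<s)))))))))))))))
      where
      s₂ = setReg s₁ (3 + b) (reg s₁ (3 + b) + reg s₁ 0)
      s₃ = setReg s₂ b (reg s₂ b + reg s₂ 1)
      s₄ = setReg s₃ (1 + b) (reg s₃ (1 + b) + reg s₃ 2)
      6≤b = 6≤frame Γ

      agree₂ : Agree b s s₂
      agree₂ = agree-setReg 3 (agree-≤ (m≤n+m b 4) p)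
      agree₃ : Agree b s s₃
      agree₃ = agree-setReg 0 agree₂
      agree₄ : Agree b s s₄
      agree₄ = agree-setReg 1 agree₃

      kept : ∀ i → i < 4 → reg s₁ (i + b) ≡ reg s (i + b)
      kept i i<4 = same-reg p (≤-trans (s<s z≤n) (≤-trans 6≤b (m≤n+m b i))) (+-monoˡ-< b i<4)



  setup-correct : ∀ {N} → n x ≤ N → Run setup (initial (encode x)) (7 + (N * 3 + 1)) (Loaded (n x))
  setup-correct n≤N =
    run-seq {b₁ = 1} (run-const (run-seq {b₁ = 1} (run-const (run-seq {b₁ = 1} (run-const (run-seq {b₁ = 1} (run-const
    (run-seq {b₁ = 1} (run-load (run-seq {b₁ = 1} (run-load (run-seq {b₁ = 1} (run-load
      (run-weaken (+-monoˡ-≤ 1 (*-monoˡ-≤ 3 n≤N))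
        (λ (i , i+0≡ , _ , l) → subst (λ i → Loaded i _) (trans (sym (+-identityʳ i)) i+0≡) l)
        (run-countdown Invariant (λ (_ , _ , counter , _) → counter) step (n x)
          (0 , refl , refl , record
            { memory = refl ; reg₁ = refl ; reg₂ = refl ; reg₃ = refl ; reg₄ = refl ; reg₅ = refl }))))))))))))))))
    where
    Invariant : ℕ → State → Set
    Invariant r s = ∃[ i ] (i + r ≡ n x × reg s 0 ≡ r × Loaded i s)

    step : ∀ {r s} → Invariant (suc r) s → Run (5 ≔ 5 ⊕ 2 ⨾ 0 ≔ 0 ⊖ 1) s 2 (Invariant r)
    step {r} {s} (i , i+r≡ , counter , l) = run-seq {b₁ = 1} (run-add (run-sub
      ( suc i , trans (sym (+-suc i r)) i+r≡ , cong₂ _∸_ counter (reg₁ l)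
      , record
          { memory = memory l ; reg₁ = reg₁ l ; reg₂ = reg₂ l ; reg₃ = reg₃ l ; reg₄ = reg₄ l
          ; reg₅ = begin
              reg s 5 + reg s 2      ≡⟨ cong₂ _+_ (reg₅ l) (reg₂ l) ⟩
              2 + i * n x + n x      ≡⟨ cong (2 +_) (+-comm (i * n x) (n x)) ⟩
              2 + (n x + i * n x)    ∎
          })))
      where open ≡-Reasoning

-- From first-order sentences to polynomial-time decision

length-encode : ∀ x → length (encode x) ≡ 2 + (n x * n x + m x * n x)
length-encode x = cong (2 +_)
  (trans (length-++ (matrix (adj (graph x))))
         (cong₂ _+_ (length-matrix (adj (graph x))) (length-matrix (λ j v → lookup (cliques x j) v))))

m≤m*m : ∀ m → m ≤ m * m
m≤m*m zero    = z≤n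
m≤m*m (suc m) = m≤m*n (suc m) (suc m)


-- The sentence is to express the negative answer. The last subtraction both negates its result and
-- turns it into a bit.
decider : Formula [] → Cmd
decider φ = setup ⨾ compile φ ⨾ 0 ≔ 1 ⊖ 0

deciderCost : Formula [] → ℕ → ℕ
deciderCost φ N = (7 + (N * 3 + 1)) + (cost φ N + 1)

deciderCost-poly : ∀ φ → PolyBounded (deciderCost φ)
deciderCost-poly φ =
  poly-+ (poly-+ (poly-const 7) (poly-+ (poly-* (poly-const 3)) (poly-const 1)))
         (poly-+ (cost-poly φ) (poly-const 1))

Answer : Set → ℕ → Set
Answer P v = (v ≡ 1 × P) ⊎ (v ≡ 0 × ¬ P)

flags⇒answer : ∀ {P Q v w} → Q ⇔ (¬ P) → Flags P v → w ≡ 1 ∸ v → Answer Q w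
flags⇒answer {v = v} Q⇔¬P (inj₁ (v≢0 , p)) eq =
  inj₂ (trans eq (m≤n⇒m∸n≡0 (n≢0⇒n>0 v≢0)) , λ q → to Q⇔¬P q p)
flags⇒answer Q⇔¬P (inj₂ (refl , ¬p)) eq = inj₁ (eq , from Q⇔¬P ¬p)

length-encode-nonZero : ∀ x → NonZero (length (encode x))
length-encode-nonZero x = _

module _ (x : Instance) (m≤n : m x ≤ n x) where

  open Semantics x
  open Correctness x

  private
    N = length (encode x)

  -- On an empty vertex set the matrices are empty whatever `m x` is, so the length alone would not
  -- bound `m x`; `m≤n` excludes this.
  size≤length : ∀ t → size t ≤ N
  size≤length t = ≤-trans (size≤n t) (begin
    n x                          ≤⟨ m≤m*m (n x) ⟩
    n x * n x                    ≤⟨ m≤m+n _ _ ⟩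
    n x * n x + m x * n x        ≤⟨ m≤n+m _ 2 ⟩
    2 + (n x * n x + m x * n x)  ≡⟨ length-encode x ⟨
    N                            ∎)
    where
    open ≤-Reasoning

    size≤n : ∀ t → size t ≤ n x
    size≤n vertex = ≤-refl
    size≤n clique = m≤n

  decider-correct : ∀ {Q : Set} φ → Q ⇔ (¬ ⟦ φ ⟧ []) →
    Run (decider φ) (initial (encode x)) (deciderCost φ N) (Answer Q ∘ output)
  decider-correct φ Q⇔¬φ =
    run-seq (run-weaken ≤-refl
      (λ l → run-seq (run-weaken ≤-refl
        (λ {s′} (p , f) → run-sub
          (flags⇒answer Q⇔¬φ f (cong (_∸ reg s′ 0) (Loaded.reg₁ (loaded-agree ≤-refl p l)))))
        (compile-correct φ [] size≤length l (λ ()))))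
      (setup-correct (size≤length vertex)))

-- The program and the polynomial depend only on the sentence, which is fixed before the input.
polyTimeDecidable : ∀ {Promise Yes : Instance → Set} (φ : Formula []) →
  (∀ x → Promise x → m x ≤ n x) →
  (∀ x → Promise x → Yes x ⇔ (¬ Semantics.⟦_⟧ x φ [])) →
  PolyTimeDecidable encode Promise Yes
polyTimeDecidable φ m≤n yes⇔ =
  let c , d , bounded = deciderCost-poly φ in
  decider φ , c , d , λ x valid →
    let t , s , p , t≤ , answer = decider-correct x (m≤n x valid) φ (yes⇔ x valid) in
    t , s , p , ≤-trans t≤ (≤-trans (bounded (length (encode x)) {{length-encode-nonZero x}}) (m≤m+n _ c)) , answer

-- Finite sets

comprehension : ∀ {n} {P : Pred (Fin n) 0ℓ} → Decidable P → Subset n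
comprehension P? = Vec.tabulate (does ∘ P?)

∈-comprehension : ∀ {n} {P : Pred (Fin n) 0ℓ} (P? : Decidable P) {v} → v ∈ comprehension P? ⇔ P v
∈-comprehension P? {v} = mk⇔
  (λ v∈ → invert (subst (Reflects _) (trans (sym (lookup∘tabulate (does ∘ P?) v)) ([]=⇒lookup v∈)) (proof (P? v))))
  (λ p → lookup⇒[]= v _ (trans (lookup∘tabulate (does ∘ P?) v) (dec-true (P? v) p)))

-- Together with `position` this identifies `S` with `Fin ∣ S ∣`, so that cardinalities can be
-- compared through injections.
members : ∀ {n} (S : Subset n) → Fin ∣ S ∣ → Fin n
members (true  ∷ S) zero    = zero
members (true  ∷ S) (suc i) = suc (members S i)
members (false ∷ S) i       = suc (members S i)

members-∈ : ∀ {n} (S : Subset n) i → members S i ∈ S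
members-∈ (true  ∷ S) zero    = here
members-∈ (true  ∷ S) (suc i) = there (members-∈ S i)
members-∈ (false ∷ S) i       = there (members-∈ S i)

members-injective : ∀ {n} (S : Subset n) → Injective _≡_ _≡_ (members S)
members-injective (true  ∷ S) {zero}  {zero}  _  = refl
members-injective (true  ∷ S) {suc i} {suc j} eq = cong suc (members-injective S (suc-injective eq))
members-injective (false ∷ S) eq = members-injective S (suc-injective eq)

position : ∀ {n} {S : Subset n} {v} → v ∈ S → Fin ∣ S ∣
position {S = true  ∷ S} here        = zero
position {S = true  ∷ S} (there v∈S) = suc (position v∈S)
position {S = false ∷ S} (there v∈S) = position v∈S

members-position : ∀ {n} {S : Subset n} {v} (v∈S : v ∈ S) → members S (position v∈S) ≡ v
members-position {S = true  ∷ S} here        = refl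
members-position {S = true  ∷ S} (there v∈S) = cong suc (members-position v∈S)
members-position {S = false ∷ S} (there v∈S) = cong suc (members-position v∈S)

position-injective : ∀ {n} {S : Subset n} {u v} (u∈S : u ∈ S) (v∈S : v ∈ S) → position u∈S ≡ position v∈S → u ≡ v
position-injective {S = S} u∈S v∈S eq =
  trans (sym (members-position u∈S)) (trans (cong (members S) eq) (members-position v∈S))

subset-of-size : ∀ {n} p (S : Subset n) → p ≤ ∣ S ∣ → ∃[ S′ ] (S′ ⊆ S × ∣ S′ ∣ ≡ p)
subset-of-size {n} zero S           p≤ = ⊥ , (λ v∈⊥ → ⊥-elim (∉⊥ v∈⊥)) , ∣⊥∣≡0 n
subset-of-size (suc p) (true ∷ S)  (s≤s p≤) =
  let S′ , S′⊆S , eq = subset-of-size p S p≤ in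
  true ∷ S′ , (λ { here → here ; (there v∈) → there (S′⊆S v∈) }) , cong suc eq
subset-of-size (suc p) (false ∷ S) p≤ =
  let S′ , S′⊆S , eq = subset-of-size (suc p) S p≤ in
  false ∷ S′ , (λ { (there v∈) → there (S′⊆S v∈) }) , eq

-- The choices for the members of `S` fill the first slots. The given element of `A` fills the rest,
-- so the number of slots is `p` whatever the size of `S`.
choose : ∀ {n p} {A : Set} (R : Fin n → A → Set) (S : Subset n) → ∣ S ∣ ≤ p → A →
         (∀ v → v ∈ S → ∃[ a ] R v a) →
         Σ (Fin p → A) λ f → ∀ v → v ∈ S → ∃[ r ] R v (f r)
choose R []          _  a₀ _ = (λ _ → a₀) , λ ()
choose {p = suc p} R (true ∷ S) (s≤s S≤p) a₀ pick =
  let a , Ra  = pick zero here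
      f , f-R = choose (R ∘ suc) S S≤p a₀ (λ v v∈S → pick (suc v) (there v∈S))
  in a Vector.∷ f , λ
    { zero    _           → zero , Ra
    ; (suc v) (there v∈S) → let r , Rr = f-R v v∈S in suc r , Rr }
choose R (false ∷ S) S≤p a₀ pick =
  let f , f-R = choose (R ∘ suc) S S≤p a₀ (λ v v∈S → pick (suc v) (there v∈S))
  in f , λ { (suc v) (there v∈S) → f-R v v∈S }

disjoint-images : ∀ {a b c} {f : Fin a → Fin c} {g : Fin b → Fin c} →
  Injective _≡_ _≡_ f → Injective _≡_ _≡_ g → (∀ i j → f i ≢ g j) → a + b ≤ c
disjoint-images {a} {b} {c} {f} {g} f-inj g-inj f≢g = injective⇒≤ {f = [ f , g ]′ ∘ splitAt a} λ {i} {j} eq →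
  trans (sym (join-splitAt a b i))
    (trans (cong (join a b) (copair-injective (splitAt a i) (splitAt a j) eq)) (join-splitAt a b j))
  where
  copair-injective : ∀ s t → [ f , g ]′ s ≡ [ f , g ]′ t → s ≡ t
  copair-injective (inj₁ i) (inj₁ j) eq = cong inj₁ (f-inj eq)
  copair-injective (inj₁ i) (inj₂ j) eq = ⊥-elim (f≢g i j eq)
  copair-injective (inj₂ i) (inj₁ j) eq = ⊥-elim (f≢g j i (sym eq))
  copair-injective (inj₂ i) (inj₂ j) eq = cong inj₂ (g-inj eq)

injection-into-⊎ : ∀ {a b c} (f : Fin c → Fin a ⊎ Fin b) → Injective _≡_ _≡_ f → c ≤ a + b
injection-into-⊎ {a} {b} f f-inj = injective⇒≤ {f = join a b ∘ f} λ {i} {j} eq →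
  f-inj (trans (sym (splitAt-join a b (f i))) (trans (cong (splitAt a) eq) (splitAt-join a b (f j))))

-- Search upwards from zero, shifting the predicate; the witness `a` limits the search.
least : ∀ {P : Pred ℕ 0ℓ} → Decidable P → ∀ a → P a → ∃[ b ] IsLeast P b
least P? a p with P? 0
... | yes p₀ = 0 , p₀ , λ _ _ → z≤n
least P? zero    p | no ¬p₀ = ⊥-elim (¬p₀ p)
least {P} P? (suc a) p | no ¬p₀ =
  let b , q , below = least (P? ∘ suc) a p in
  suc b , q , λ { zero p₀ → ⊥-elim (¬p₀ p₀) ; (suc j) pⱼ → s≤s (below j pⱼ) }

-- Maximal independent sets

module _ {n} (G : Graph n) where

  Free : Subset n → Fin n → Set
  Free S v = v ∉ S × (∀ u → u ∈ S → ¬ Adj G v u)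

  free? : ∀ S → Decidable (Free S)
  free? S v = ¬? (v ∈? S) ×-dec all? (λ u → (u ∈? S) →-dec ¬? (T? (adj G v u)))

  independent? : Decidable (IsIndependent G)
  independent? S = map′ (λ ind {u} {v} u∈S v∈S → ind u v u∈S v∈S) (λ ind u v → ind)
    (all? λ u → all? λ v → (u ∈? S) →-dec ((v ∈? S) →-dec ¬? (T? (adj G u v))))

  insert-independent : ∀ {S v} → IsIndependent G S → Free S v → IsIndependent G (S ∪ ⁅ v ⁆)
  insert-independent {S} {v} ind (_ , free) a∈ b∈ with x∈p∪q⁻ S ⁅ v ⁆ a∈ | x∈p∪q⁻ S ⁅ v ⁆ b∈
  ... | inj₁ a∈S | inj₁ b∈S = ind a∈S b∈S
  ... | inj₁ a∈S | inj₂ b∈v rewrite x∈⁅y⁆⇒x≡y v b∈v = free _ a∈S ∘ adj-sym G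
  ... | inj₂ a∈v | inj₁ b∈S rewrite x∈⁅y⁆⇒x≡y v a∈v = free _ b∈S
  ... | inj₂ a∈v | inj₂ b∈v rewrite x∈⁅y⁆⇒x≡y v a∈v | x∈⁅y⁆⇒x≡y v b∈v = adj-irrefl G refl

  -- Every vertex of an independent superset that lies outside `S` is free, so one-vertex extensions
  -- decide maximality.
  maximal⇔ : ∀ {S} → IsMaximalIndependent G S ⇔ (IsIndependent G S × (∀ v → ¬ Free S v))
  maximal⇔ {S} = mk⇔
    (λ (ind , maximal) → ind , λ v free →
      proj₁ free (maximal _ (insert-independent ind free) (p⊆p∪q ⁅ v ⁆) (q⊆p∪q S ⁅ v ⁆ (x∈⁅x⁆ v))))
    (λ (ind , ¬free) → ind , λ S′ ind′ S⊆S′ {v} v∈S′ → decidable-stable (v ∈? S)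
      (λ v∉S → ¬free v (v∉S , λ u u∈S → ind′ v∈S′ (S⊆S′ u∈S))))

  maximal? : Decidable (IsMaximalIndependent G)
  maximal? S = map′ (from maximal⇔) (to maximal⇔) (independent? S ×-dec all? (¬? ∘ free? S))

  neighbour : ∀ {S v} → IsMaximalIndependent G S → v ∉ S → ∃[ u ] (u ∈ S × Adj G v u)
  neighbour {S} {v} maximal v∉S with any? (λ u → (u ∈? S) ×-dec T? (adj G v u))
  ... | yes found = found
  ... | no ¬found = ⊥-elim (proj₂ (to maximal⇔ maximal) v (v∉S , λ u u∈S adj → ¬found (u , u∈S , adj)))

  -- Insert free vertices as long as there are any; the set grows strictly, so this ends.
  extend : ∀ S → IsIndependent G S → ∃[ S′ ] (S ⊆ S′ × IsMaximalIndependent G S′)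
  extend S = go S (⊃-wellFounded S)
    where
    go : ∀ S → Acc _⊃_ S → IsIndependent G S → ∃[ S′ ] (S ⊆ S′ × IsMaximalIndependent G S′)
    go S (acc rec) ind with any? (free? S)
    ... | no ¬free = S , id , from maximal⇔ (ind , λ v free → ¬free (v , free))
    ... | yes (v , free) =
      let S′ , ⊆S′ , maximal = go (S ∪ ⁅ v ⁆)
            (rec (p⊆p∪q ⁅ v ⁆ , v , q⊆p∪q S ⁅ v ⁆ (x∈⁅x⁆ v) , proj₁ free)) (insert-independent ind free)
      in S′ , ⊆S′ ∘ p⊆p∪q ⁅ v ⁆ , maximal

  i-exists : ∃[ b ] Isi G b
  i-exists =
    let S , _ , maximal = extend ⊥ (λ u∈⊥ → ⊥-elim (∉⊥ u∈⊥)) in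
    least (λ s → anySubset? (λ S → maximal? S ×-dec (∣ S ∣ ≟ s))) ∣ S ∣ (S , maximal , refl)

  -- Certificates of a large independence gap

  -- `D` may repeat vertices, which is harmless as no vertex is adjacent to itself. Every vertex of
  -- a selected clique has a neighbour in `D`, so no independent superset of `D` meets the clique.
  record Certificate {L K m} (Q : Fin m → Subset n) (D : Fin L → Fin n) (j : Fin K → Fin m) : Set where
    field
      independent : ∀ a b → ¬ Adj G (D a) (D b)
      distinct    : ∀ {i i′} → i ≢ i′ → j i ≢ j i′
      dominated   : ∀ i → ¬ (∃[ v ] (v ∈ Q (j i) × ∀ a → ¬ Adj G v (D a)))

  open Certificate

  -- Extend the image of `D` to a maximal independent set `S`. Sending each member of `S` to a
  -- clique containing it is injective and avoids the `K` dominated cliques.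
  certificate-sound : ∀ {L K m} {Q : Fin m → Subset n} {D : Fin L → Fin n} {j : Fin K → Fin m} →
    IsCliqueCover G Q → Certificate Q D j → ∃[ S ] (IsMaximalIndependent G S × ∣ S ∣ + K ≤ m)
  certificate-sound {Q = Q} {D} {j} (isClique , cover) cert =
    let S , D⊆S , maximal = extend image image-independent in
    S , maximal , bound S D⊆S (proj₁ maximal)
    where
    image? : Decidable (λ v → ∃[ a ] D a ≡ v)
    image? v = any? (λ a → D a ≟ᶠ v)
    image = comprehension image?

    image-independent : IsIndependent G image
    image-independent u∈ v∈ with to (∈-comprehension image?) u∈ | to (∈-comprehension image?) v∈
    ... | a , refl | b , refl = independent cert a b

    bound : ∀ S → image ⊆ S → IsIndependent G S → _
    bound S D⊆S ind = disjoint-images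
      {f = λ i → proj₁ (cover (members S i))} {g = j}
      (λ {a} {b} eq → members-injective S (same-part (members-∈ S a) (members-∈ S b) (proj₂ (cover _))
                        (subst (λ q → members S b ∈ Q q) (sym eq) (proj₂ (cover _)))))
      (λ {i} {i′} eq → decidable-stable (i ≟ᶠ i′) (λ i≢i′ → distinct cert i≢i′ eq))
      (λ a i eq → dominated cert i (members S a , subst (λ q → members S a ∈ Q q) eq (proj₂ (cover _)) ,
                    λ b → ind (members-∈ S a) (D⊆S (from (∈-comprehension image?) (b , refl)))))
      where
      same-part : ∀ {u v q} → u ∈ S → v ∈ S → u ∈ Q q → v ∈ Q q → u ≡ v
      same-part {u} {v} u∈S v∈S u∈Q v∈Q =
        decidable-stable (u ≟ᶠ v) (λ u≢v → ind u∈S v∈S (isClique _ u∈Q v∈Q u≢v))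

  -- By counting, `S` misses at least `K` cliques. By maximality each vertex of a missed clique has
  -- a neighbour in `S`, and `p` slots per clique hold these neighbours. The given vertex guarantees
  -- that `S` is nonempty.
  certificate-complete : ∀ {K m p S} {Q : Fin m → Subset n} → K[ G ]-Free p → IsCliquePartition G Q → Fin n →
    IsMaximalIndependent G S → ∣ S ∣ + K ≤ m →
    ∃[ D ] ∃[ j ] Certificate {K * p} {K} Q D j
  certificate-complete {K} {m} {p} {S} {Q} Kₚ-free ((isClique , _) , disjoint) v₀ maximal S+K≤m =
    D , j , record
      { independent = λ a b → proj₁ maximal (proj₂ (D∈S a)) (proj₂ (D∈S b))
      ; distinct    = λ i≢i′ eq → i≢i′ (inject≤-injective K≤missed K≤missed _ _ (members-injective missed eq))
      ; dominated   = λ i (v , v∈Q , undominated) →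
          let r , adj = proj₂ (part i) v v∈Q in
          undominated (combine i r)
            (subst (λ (i , r) → Adj G v (proj₁ (proj₁ (part i) r))) (sym (remQuot-combine i r)) adj)
      }
    where
    missed? : Decidable (λ q → ¬ (∃[ v ] (v ∈ Q q × v ∈ S)))
    missed? q = ¬? (any? λ v → (v ∈? Q q) ×-dec (v ∈? S))
    missed = comprehension missed?

    hit : ∀ q → q ∉ missed → ∃[ v ] (v ∈ Q q × v ∈ S)
    hit q q∉ = decidable-stable (any? λ v → (v ∈? Q q) ×-dec (v ∈? S)) (q∉ ∘ from (∈-comprehension missed?))

    classify : ∀ q → q ∈ missed ⊎ (∃[ v ] (v ∈ Q q × v ∈ S))
    classify q with q ∈? missed
    ... | yes q∈ = inj₁ q∈
    ... | no q∉  = inj₂ (hit q q∉)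

    -- A clique that is hit is represented by a member of `S` in it. Disjointness makes this
    -- injective, whence `m` is at most the number of missed cliques plus the size of `S`.
    code : ∀ {q} → q ∈ missed ⊎ (∃[ v ] (v ∈ Q q × v ∈ S)) → Fin ∣ missed ∣ ⊎ Fin ∣ S ∣
    code = Sum.map position (λ (_ , _ , v∈S) → position v∈S)

    code-injective : ∀ {q q′} c c′ → code {q} c ≡ code {q′} c′ → q ≡ q′
    code-injective (inj₁ q∈) (inj₁ q′∈) eq = position-injective q∈ q′∈ (inj₁-injective eq)
    code-injective {q} {q′} (inj₂ (v , v∈Q , v∈S)) (inj₂ (v′ , v′∈Q , v′∈S)) eq
      with refl ← position-injective v∈S v′∈S (inj₂-injective eq) =
      decidable-stable (q ≟ᶠ q′) (λ q≢q′ → disjoint q≢q′ (v , x∈p∩q⁺ (v∈Q , v′∈Q)))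

    K≤missed : K ≤ ∣ missed ∣
    K≤missed = +-cancelˡ-≤ (∣ S ∣) K (∣ missed ∣) (begin
      ∣ S ∣ + K           ≤⟨ S+K≤m ⟩
      m                   ≤⟨ injection-into-⊎ (code ∘ classify)
                               (λ {q} {q′} → code-injective (classify q) (classify q′)) ⟩
      ∣ missed ∣ + ∣ S ∣  ≡⟨ +-comm (∣ missed ∣) (∣ S ∣) ⟩
      ∣ S ∣ + ∣ missed ∣  ∎)
      where open ≤-Reasoning

    j : Fin K → Fin m
    j i = members missed (inject≤ i K≤missed)

    j-missed : ∀ i {v} → v ∈ Q (j i) → v ∉ S
    j-missed i v∈Q v∈S = to (∈-comprehension missed?) (members-∈ missed _) (_ , v∈Q , v∈S)

    element : ∃[ v ] v ∈ S
    element with v₀ ∈? S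
    ... | yes v₀∈S = v₀ , v₀∈S
    ... | no v₀∉S  = let u , u∈S , _ = neighbour maximal v₀∉S in u , u∈S

    -- A clique with `p` or more vertices contains one with exactly `p`.
    clique-size : ∀ q → ∣ Q q ∣ ≤ p
    clique-size q with ≤-total ∣ Q q ∣ p
    ... | inj₁ ≤p = ≤p
    ... | inj₂ p≤ =
      let S′ , S′⊆Q , eq = subset-of-size p (Q q) p≤ in
      ⊥-elim (Kₚ-free (S′ , (λ u∈ v∈ → isClique q (S′⊆Q u∈) (S′⊆Q v∈)) , eq))

    part : ∀ i → ∃[ f ] (∀ v → v ∈ Q (j i) → ∃[ r ] Adj G v (proj₁ (f r)))
    part i = choose {p = p} (λ v (u , _) → Adj G v u) (Q (j i)) (clique-size (j i)) element (λ v v∈Q →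
      let u , u∈S , adj = neighbour maximal (j-missed i v∈Q) in (u , u∈S) , adj)

    D∈S : Fin (K * p) → ∃[ v ] v ∈ S
    D∈S a = let i , r = remQuot {K} p a in proj₁ (part i) r

    D : Fin (K * p) → Fin n
    D = proj₁ ∘ D∈S

-- The sentence expressing that a certificate exists

-- The innermost quantifier is added first, so that the contexts match by computation.
∃̇^ : ∀ s L {Γ} → Formula (replicate L s ++ Γ) → Formula Γ
∃̇^ s zero    φ = φ
∃̇^ s (suc L) φ = ∃̇^ s L (∃̇ s φ)

bound : ∀ {s L Γ} → Fin L → Var s (replicate L s ++ Γ)
bound zero    = here refl
bound (suc i) = there (bound i)

outer : ∀ {s t} L {Γ} → Var t Γ → Var t (replicate L s ++ Γ)
outer zero    v = v
outer (suc L) v = there (outer L v)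

⋀ : ∀ {L Γ} → (Fin L → Formula Γ) → Formula Γ
⋀ {zero}  φ = ⊤̇
⋀ {suc L} φ = φ zero ∧̇ ⋀ (φ ∘ suc)

module _ (x : Instance) where

  open Semantics x

  assign : ∀ s {L Γ} → (Fin L → Fin (size s)) → Env Γ → Env (replicate L s ++ Γ)
  assign s {zero}  f ρ = ρ
  assign s {suc L} f ρ = f zero ∷ assign s (f ∘ suc) ρ

  lookup-bound : ∀ s {L Γ} (f : Fin L → Fin (size s)) (ρ : Env Γ) i →
                 All.lookup (assign s f ρ) (bound i) ≡ f i
  lookup-bound s f ρ zero    = refl
  lookup-bound s f ρ (suc i) = lookup-bound s (f ∘ suc) ρ i

  lookup-outer : ∀ s L {t Γ} (f : Fin L → Fin (size s)) (ρ : Env Γ) (v : Var t Γ) →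
                 All.lookup (assign s f ρ) (outer L v) ≡ All.lookup ρ v
  lookup-outer s zero    f ρ v = refl
  lookup-outer s (suc L) f ρ v = lookup-outer s L (f ∘ suc) ρ v

  ∃̇^-⇔ : ∀ s L {Γ} (φ : Formula (replicate L s ++ Γ)) (ρ : Env Γ) →
          ⟦ ∃̇^ s L φ ⟧ ρ ⇔ (Σ (Fin L → Fin (size s)) λ f → ⟦ φ ⟧ (assign s f ρ))
  ∃̇^-⇔ s zero    φ ρ = mk⇔ (λ p → (λ ()) , p) proj₂
  ∃̇^-⇔ s (suc L) φ ρ = mk⇔
    (λ p → let f , a , q = to (∃̇^-⇔ s L (∃̇ s φ) ρ) p in a Vector.∷ f , q)
    (λ (f , q) → from (∃̇^-⇔ s L (∃̇ s φ) ρ) (f ∘ suc , f zero , q))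

  ⋀-⇔ : ∀ {L Γ} (φ : Fin L → Formula Γ) (ρ : Env Γ) → ⟦ ⋀ φ ⟧ ρ ⇔ (∀ i → ⟦ φ i ⟧ ρ)
  ⋀-⇔ {zero}  φ ρ = mk⇔ (λ _ ()) _
  ⋀-⇔ {suc L} φ ρ = mk⇔
    (λ { (p , ps) zero → p ; (p , ps) (suc i) → to (⋀-⇔ (φ ∘ suc) ρ) ps i })
    (λ ps → ps zero , from (⋀-⇔ (φ ∘ suc) ρ) (ps ∘ suc))

-- Looking up the variables of an assigned environment returns the original families only pointwise.
certificate-cong : ∀ {n L K m} (G : Graph n) {Q : Fin m → Subset n} {D D′ : Fin L → Fin n} {j j′ : Fin K → Fin m} →
  D ≗ D′ → j ≗ j′ → Certificate G Q D j → Certificate G Q D′ j′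
certificate-cong G {Q} D≗ j≗ cert = record
  { independent = λ a b → subst₂ (λ u v → ¬ Adj G u v) (D≗ a) (D≗ b) (independent a b)
  ; distinct    = λ i≢i′ eq → distinct i≢i′ (trans (j≗ _) (trans eq (sym (j≗ _))))
  ; dominated   = λ i (v , v∈ , undominated) → dominated i
      (v , subst (λ q → v ∈ Q q) (sym (j≗ i)) v∈ , λ a → undominated a ∘ subst (Adj G v) (D≗ a))
  }
  where open Certificate cert

module CertificateSentence (L K : ℕ) where

  Γ : Context
  Γ = replicate K clique ++ replicate L vertex ++ []

  dominator : Fin L → Var vertex Γ
  dominator a = outer K (bound a)

  part : Fin K → Var clique Γ
  part = bound

  nonadjacent : Fin L → Fin L → Formula Γ
  nonadjacent a b = ¬̇ (dominator a ∼ dominator b)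

  -- The indices are compared while the sentence is built; on the diagonal the inequation would be
  -- false.
  unequal : Fin K → Fin K → Formula Γ
  unequal i i′ = if does (i ≟ᶠ i′) then ⊤̇ else part i ≠̇ part i′

  undominatedBy : Fin L → Formula (vertex ∷ Γ)
  undominatedBy a = ¬̇ (here refl ∼ there (dominator a))

  dominated : Fin K → Formula Γ
  dominated i = ¬̇ ∃̇ vertex (here refl ε there (part i) ∧̇ ⋀ undominatedBy)

  isCertificate : Formula Γ
  isCertificate =
    ⋀ (λ a → ⋀ (nonadjacent a)) ∧̇ ⋀ (λ i → ⋀ (unequal i)) ∧̇ ⋀ dominated

  hasCertificate : Formula []
  hasCertificate = ∃̇^ vertex L (∃̇^ clique K isCertificate)

  module _ (x : Instance) where

    open Semantics x

    unequal-⇔ : ∀ ρ i i′ → ⟦ unequal i i′ ⟧ ρ ⇔ (i ≢ i′ → All.lookup ρ (part i) ≢ All.lookup ρ (part i′))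
    unequal-⇔ ρ i i′ with i ≟ᶠ i′
    ... | yes i≡i′ = mk⇔ (λ _ i≢i′ → ⊥-elim (i≢i′ i≡i′)) _
    ... | no i≢i′  = mk⇔ (λ p _ → p) (λ p → p i≢i′)

    Certified : Env Γ → Set
    Certified ρ = Certificate (graph x) (cliques x) (All.lookup ρ ∘ dominator) (All.lookup ρ ∘ part)

    isCertificate-⇔ : ∀ ρ → ⟦ isCertificate ⟧ ρ ⇔ Certified ρ
    isCertificate-⇔ ρ = mk⇔ certified expressed
      where
      certified : ⟦ isCertificate ⟧ ρ → Certified ρ
      certified (ind , dist , dom) = record
        { independent = λ a → to (⋀-⇔ x (nonadjacent a) ρ) (to (⋀-⇔ x (⋀ ∘ nonadjacent) ρ) ind a)
        ; distinct    = λ {i} {i′} →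
            to (unequal-⇔ ρ i i′) (to (⋀-⇔ x (unequal i) ρ) (to (⋀-⇔ x (⋀ ∘ unequal) ρ) dist i) i′)
        ; dominated   = λ i (v , v∈ , und) →
            to (⋀-⇔ x dominated ρ) dom i (v , v∈ , from (⋀-⇔ x undominatedBy (v ∷ ρ)) und)
        }

      expressed : Certified ρ → ⟦ isCertificate ⟧ ρ
      expressed cert =
        from (⋀-⇔ x (⋀ ∘ nonadjacent) ρ) (λ a → from (⋀-⇔ x (nonadjacent a) ρ) (C.independent a)) ,
        from (⋀-⇔ x (⋀ ∘ unequal) ρ) (λ i →
          from (⋀-⇔ x (unequal i) ρ) (λ i′ → from (unequal-⇔ ρ i i′) C.distinct)) ,
        from (⋀-⇔ x dominated ρ) (λ i (v , v∈ , und) →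
          C.dominated i (v , v∈ , to (⋀-⇔ x undominatedBy (v ∷ ρ)) und))
        where module C = Certificate cert

    hasCertificate-⇔ : ⟦ hasCertificate ⟧ [] ⇔ (∃[ D ] ∃[ j ] Certificate (graph x) {L} {K} (cliques x) D j)
    hasCertificate-⇔ = mk⇔
      (λ p → let D , q = to (∃̇^-⇔ x vertex L _ []) p
                 j , r = to (∃̇^-⇔ x clique K _ (assign x vertex D [])) q
             in _ , _ , to (isCertificate-⇔ _) r)
      (λ (D , j , cert) →
        let ρ = assign x vertex D [] in
        from (∃̇^-⇔ x vertex L _ []) (D , from (∃̇^-⇔ x clique K _ ρ) (j , from (isCertificate-⇔ _)
          (certificate-cong (graph x)
            (λ a → sym (trans (lookup-outer x clique K j ρ (bound a)) (lookup-bound x vertex D [] a)))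
            (λ i → sym (lookup-bound x clique j ρ i))
            cert))))

-- The independence gap and the sentence

open CertificateSentence using (hasCertificate; hasCertificate-⇔)

-- A certificate for `suc k` cliques yields a maximal independent set at least `suc k` below α.
-- Conversely, if the gap exceeds `k`, a smallest maximal independent set yields a certificate.
gap-⇔ : ∀ p k x → ValidInput p x → GapAtMost k x ⇔ (¬ Semantics.⟦_⟧ x (hasCertificate (suc k * p) (suc k)) [])
gap-⇔ p k x (Kₚ-free , _ , partition@(cover , _) , α@((S₀ , _ , ∣S₀∣≡m) , _)) = mk⇔ small⇒none none⇒small
  where
  G = graph x

  small⇒none : GapAtMost k x → ¬ Semantics.⟦_⟧ x (hasCertificate (suc k * p) (suc k)) []
  small⇒none (g , (a , b , (_ , a-max) , (_ , b-min) , refl) , g≤k) holds =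
    let _ , _ , cert       = to (hasCertificate-⇔ (suc k * p) (suc k) x) holds
        S , maximal , S+K≤m = certificate-sound G cover cert
    in <⇒≱ (begin-strict
         k            <⟨ n<1+n k ⟩
         suc k        ≤⟨ m+n≤o⇒m≤o∸n (suc k) (≤-trans (≤-reflexive (+-comm (suc k) (∣ S ∣))) S+K≤m) ⟩
         m x ∸ ∣ S ∣  ≤⟨ ∸-mono (a-max (m x) (proj₁ α)) (b-min (∣ S ∣) (S , maximal , refl)) ⟩
         a ∸ b        ∎) g≤k
    where open ≤-Reasoning

  none⇒small : ¬ Semantics.⟦_⟧ x (hasCertificate (suc k * p) (suc k)) [] → GapAtMost k x
  none⇒small ¬holds with i-exists G
  ... | b , i@((S , maximal , ∣S∣≡b) , _) = m x ∸ b , (m x , b , α , i , refl) , ≮⇒≥ λ k<m∸b →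
    -- A difference above `k` is nonzero, so here the subtraction is not truncated.
    let b≤m   = <⇒≤ (m∸n≢0⇒n<m (λ eq → n≮0 (subst (k <_) eq k<m∸b)))
        K+b≤m = m≤o∸n⇒m+n≤o (suc k) b≤m k<m∸b
        S+K≤m = ≤-trans (≤-reflexive (trans (cong (_+ suc k) ∣S∣≡b) (+-comm b (suc k)))) K+b≤m
        -- A vertex exists, since a maximum independent set has `m x ≥ suc k` members.
        v₀    = members S₀ (inject≤ {1} zero (subst (1 ≤_) (sym ∣S₀∣≡m) (≤-trans (s≤s z≤n) K+b≤m)))
    in ¬holds (from (hasCertificate-⇔ (suc k * p) (suc k) x)
         (certificate-complete G Kₚ-free partition v₀ maximal S+K≤m))

mainTheorem6 : ∀ (p k : ℕ) → 1 ≤ p → 1 ≤ k →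
    PolyTimeDecidable encode (ValidInput p) (GapAtMost k)
mainTheorem6 p k _ _ = polyTimeDecidable (hasCertificate (suc k * p) (suc k))
  -- The number of cliques is the size of an independent set, hence at most the number of vertices.
  (λ { x (_ , _ , _ , (S , _ , ∣S∣≡m) , _) → subst (_≤ n x) ∣S∣≡m (∣p∣≤n S) })
  (gap-⇔ p k)
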